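{- Consider the uniform coloring game and let $L(1,n)$ be the maximum, over all uniform coloring games with at most $n$ players, of the length of a sequence of $1$-deviations. Let $m$ and $r$ be the unique non-negative integers such that $n = \frac{m(m+1)}{2} + r$ and $0 \le r \le m$. Then $L(1,n) = 2\binom{m+1}{3} + mr$. In particular $L(1,n) \sim \frac{2}{3} n\sqrt{n}$ as $n \to \infty$.
   Context: A coloring game is given by a finite set $V$ of $n$ players and a symmetric weight function $w$ assigning to each pair of distinct players $u,v$ a weight $w_{uv}=w_{vu}\in \mathbb{Z}\cup\{ -\infty\}$. A state is a partition $P$ of $V$ into groups; $X(u)$ denotes the group of $u$. The utility of $u$ is $f_u(P)=\sum_{v\in X(u)\setminus\{u\}} w_{uv}$. For an integer $k\ge 1$, a $k$-deviation from $P$ is a set $S$ of at most $k$ players together with a group $X$ of $P$ (possibly empty, i.e. a new group) such that, after removing the players of $S$ from their groups and putting them all into $X$, every $u\in S$ has strictly larger utility. The game starts from the partition into $n$ singletons and repeatedly applies an arbitrary $k$-deviation as long as one exists. The game is uniform if every weight lies in $\{ -\infty,1\}$. $L(k,n)$ denotes the maximum length of a sequence of successive $k$-deviations (starting from the all-singletons partition) over all uniform coloring games with at most $n$ players.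
   Formalization: The closing asymptotic is left out: as printed it is false, since the exact formula gives L(1,n) ~ (2√2/3) n√n = (2/3) n√(2n), not (2/3) n√n; the exact formula for L(1,n) is stated in full. -}

module Defs where

open import Data.Nat using (ℕ; zero; suc; _≤_)
open import Data.Integer as ℤ using (ℤ; +_)
open import Data.Fin using (Fin; toℕ)
open import Data.Fin.Properties using () renaming (_≟_ to _≟ᶠ_)
open import Data.Nat.Properties using () renaming (_≟_ to _≟ⁿ_)
open import Data.List using (List; foldr; allFin)
open import Data.Product using (Σ; _×_)
open import Data.Sum using (_⊎_)
open import Relation.Binary.PropositionalEquality using (_≡_; _≢_)
open import Relation.Nullary using (yes; no)

data ℤ∞ : Set where
  -∞  : ℤ∞
  fin : ℤ → ℤ∞

_+∞_ : ℤ∞ → ℤ∞ → ℤ∞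
-∞    +∞ _     = -∞
fin _ +∞ -∞    = -∞
fin a +∞ fin b = fin (a ℤ.+ b)

data _<∞_ : ℤ∞ → ℤ∞ → Set where
  -∞<fin  : ∀ {b} → -∞ <∞ fin b
  fin<fin : ∀ {a b} → a ℤ.< b → fin a <∞ fin b

record Game (p : ℕ) : Set where
  field
    w   : Fin p → Fin p → ℤ∞
    sym : ∀ u v → w u v ≡ w v u

Uniform : ∀ {p} → Game p → Set
Uniform {p} G = ∀ (u v : Fin p) → u ≢ v → (Game.w G u v ≡ -∞) ⊎ (Game.w G u v ≡ fin (+ 1))

-- A state (partition) is represented by a coloring: X(u) = { v | c v ≡ c u }
State : ℕ → Set
State p = Fin p → ℕ

singletons : ∀ {p} → State p
singletons = toℕ

utility : ∀ {p} → Game p → State p → Fin p → ℤ∞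
utility {p} G c u = foldr step (fin (+ 0)) (allFin p)
  where
  step : Fin p → ℤ∞ → ℤ∞
  step v acc with v ≟ᶠ u | c v ≟ⁿ c u
  ... | no _ | yes _ = Game.w G u v +∞ acc
  ... | _    | _     = acc

-- move player u into the group of color j (an existing group, or a new one if j unused)
move : ∀ {p} → State p → Fin p → ℕ → State p
move c u j v with v ≟ᶠ u
... | yes _ = j
... | no _  = c v

OneDev : ∀ {p} → Game p → State p → State p → Set
OneDev {p} G c c' =
  Σ (Fin p) λ u → Σ ℕ λ j →
    (∀ v → c' v ≡ move c u j v) × (utility G c u <∞ utility G c' u)

data Run {p} (G : Game p) : State p → ℕ → Set where
  done : ∀ {c} → Run G c 0
  step : ∀ {c c' k} → OneDev G c c' → Run G c' k → Run G c (suc k)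

-- Groups stay cliques, so a deviation moves a player between groups whose other members number a and b,
-- with a < b: a cell of the Young diagram of group sizes goes from column a to column b (from 0), and
-- upwards. Fix a partition ρ of n. Let X k and Y l count the cells of the current diagram below row k and
-- right of column l, and x k, y l those of ρ; then n ≤ k l + x k + y l. A deviation never increases X k and
-- never decreases Y l. For k and l = a + 1 given by the corner left by the moving cell, X k drops, Y l grows
-- and X k + Y l + k l is the number of players, so X k ≤ x k or Y l < y l, and one of the potentials
-- Σ min (X k) (x k), Σ min (Y l) (y l) over k, l ≥ 1 changes. Hence a run has at most Σ x k + Σ y l steps,
-- which for the staircase ρ (m, …, 1 plus r cells on the next diagonal) is the claimed value.
-- The bound is attained when all weights are 1: single players walk through groups of increasing size,
-- first building the staircase, then joining its largest group one after the other.
module Submission where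

open import Defs
open import Data.Bool using (if_then_else_)
open import Data.Empty using (⊥-elim)
open import Data.Fin using (Fin; toℕ; fromℕ<)
open import Data.Fin.Properties using (toℕ<n; toℕ-injective; toℕ-fromℕ<; fromℕ<-toℕ) renaming (_≟_ to _≟ᶠ_)
import Data.Integer as ℤ
open import Data.List using (List; []; _∷_; foldr; drop; length; upTo; applyUpTo; allFin)
open import Data.List.Properties using (length-tabulate; length-upTo)
open import Data.List.Membership.Propositional using (_∈_)
open import Data.List.Membership.Propositional.Properties using (∈-upTo⁺; ∈-upTo⁻; ∈-allFin)
open import Data.List.Relation.Unary.All as All using ()
open import Data.List.Relation.Unary.AllPairs using (_∷_)
open import Data.List.Relation.Unary.Any using (here; there)
open import Data.List.Relation.Unary.Unique.Propositional using (Unique)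
open import Data.List.Relation.Unary.Unique.Propositional.Properties using (upTo⁺; allFin⁺)
open import Data.Nat
open import Data.Nat.Combinatorics using (_C_; nC1≡n; nCk+nC[k+1]≡[n+1]C[k+1])
open import Data.Nat.ListAction using (sum)
open import Data.Nat.Properties
open import Data.Nat.Tactic.RingSolver using (solve-∀)
open import Data.Product using (Σ; ∃; _×_; _,_; proj₁)
open import Data.Sum using (_⊎_; inj₁; inj₂)
open import Function using (_∘_; id)
open import Relation.Binary.Definitions using (tri<; tri≈; tri>)
open import Relation.Binary.PropositionalEquality
open import Relation.Nullary using (¬_; Dec; yes; no; does)

-- Indicators and finite sums over lists

private variable
  A A′ : Set

⟦_⟧ : {P : Set} → Dec P → ℕ
⟦ d ⟧ = if does d then 1 else 0

⟦⟧-true : {P : Set} (d : Dec P) → P → ⟦ d ⟧ ≡ 1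
⟦⟧-true (yes _) _ = refl
⟦⟧-true (no ¬p) p = ⊥-elim (¬p p)

⟦⟧-false : {P : Set} (d : Dec P) → ¬ P → ⟦ d ⟧ ≡ 0
⟦⟧-false (yes p) ¬p = ⊥-elim (¬p p)
⟦⟧-false (no _)  _  = refl

⟦⟧-mono : {P Q : Set} (d : Dec P) (e : Dec Q) → (P → Q) → ⟦ d ⟧ ≤ ⟦ e ⟧
⟦⟧-mono (no _)  _ _   = z≤n
⟦⟧-mono (yes p) e P⇒Q = ≤-reflexive (sym (⟦⟧-true e (P⇒Q p)))

⟦⟧≤1 : {P : Set} (d : Dec P) → ⟦ d ⟧ ≤ 1
⟦⟧≤1 (yes _) = ≤-refl
⟦⟧≤1 (no _)  = z≤n

∑ : List A → (A → ℕ) → ℕ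
∑ []       f = 0
∑ (x ∷ xs) f = f x + ∑ xs f

∑-cong : ∀ (xs : List A) {f g} → (∀ x → f x ≡ g x) → ∑ xs f ≡ ∑ xs g
∑-cong []       f≗g = refl
∑-cong (x ∷ xs) f≗g = cong₂ _+_ (f≗g x) (∑-cong xs f≗g)

∑-mono : ∀ (xs : List A) {f g} → (∀ x → f x ≤ g x) → ∑ xs f ≤ ∑ xs g
∑-mono []       f≤g = z≤n
∑-mono (x ∷ xs) f≤g = +-mono-≤ (f≤g x) (∑-mono xs f≤g)

∑-strict : ∀ {xs : List A} {f g y} → (∀ x → f x ≤ g x) → y ∈ xs → f y < g y → ∑ xs f < ∑ xs g
∑-strict {xs = _ ∷ xs} f≤g (here refl)  fy<gy = +-mono-<-≤ fy<gy (∑-mono xs f≤g)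
∑-strict {xs = x ∷ _}  f≤g (there y∈xs) fy<gy = +-mono-≤-< (f≤g x) (∑-strict f≤g y∈xs fy<gy)

interchange : ∀ a b c d → (a + b) + (c + d) ≡ (a + c) + (b + d)
interchange = solve-∀

∑-+ : ∀ (xs : List A) f g → ∑ xs (λ x → f x + g x) ≡ ∑ xs f + ∑ xs g
∑-+ []       f g = refl
∑-+ (x ∷ xs) f g = trans (cong (f x + g x +_) (∑-+ xs f g)) (interchange (f x) (g x) _ _)

∑-*ʳ : ∀ (xs : List A) f k → ∑ xs (λ x → f x * k) ≡ ∑ xs f * k
∑-*ʳ []       f k = refl
∑-*ʳ (x ∷ xs) f k = trans (cong (f x * k +_) (∑-*ʳ xs f k)) (sym (*-distribʳ-+ k (f x) _))

∑-0 : ∀ (xs : List A) → ∑ xs (λ _ → 0) ≡ 0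
∑-0 []       = refl
∑-0 (_ ∷ xs) = ∑-0 xs

∑-swap : ∀ (xs : List A) (ys : List A′) (f : A → A′ → ℕ) → ∑ xs (λ x → ∑ ys (f x)) ≡ ∑ ys (λ y → ∑ xs (λ x → f x y))
∑-swap []       ys f = sym (∑-0 ys)
∑-swap (x ∷ xs) ys f = trans (cong (∑ ys (f x) +_) (∑-swap xs ys f)) (sym (∑-+ ys (f x) _))

∑-≤length : ∀ (xs : List A) {f} → (∀ x → f x ≤ 1) → ∑ xs f ≤ length xs
∑-≤length []       f≤1 = z≤n
∑-≤length (x ∷ xs) f≤1 = +-mono-≤ (f≤1 x) (∑-≤length xs f≤1)

∑-positive : ∀ (xs : List A) {f} → 0 < ∑ xs f → ∃ λ x → 0 < f x
∑-positive (x ∷ xs) {f} 0<∑ with f x in eq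
... | suc _ = x , subst (0 <_) (sym eq) z<s
... | zero  = ∑-positive xs 0<∑

∑-cong-∈ : ∀ (xs : List A) {f g} → (∀ {x} → x ∈ xs → f x ≡ g x) → ∑ xs f ≡ ∑ xs g
∑-cong-∈ []       f≗g = refl
∑-cong-∈ (x ∷ xs) f≗g = cong₂ _+_ (f≗g (here refl)) (∑-cong-∈ xs (f≗g ∘ there))

∑-update : ∀ {xs : List A} {f g : A → ℕ} {y} e → Unique xs → y ∈ xs →
           (∀ x → x ≢ y → g x ≡ f x) → g y ≡ e + f y → ∑ xs g ≡ e + ∑ xs f
∑-update {xs = x ∷ xs} {f} e (x∉xs ∷ _) (here refl) off on = trans
  (cong₂ _+_ on (∑-cong-∈ xs λ z∈xs → off _ (λ z≡x → All.lookup x∉xs z∈xs (sym z≡x))))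
  (+-assoc e (f x) _)
∑-update {xs = x ∷ xs} {f} e (x∉xs ∷ uniq) (there y∈xs) off on = trans
  (cong₂ _+_ (off x (All.lookup x∉xs y∈xs)) (∑-update e uniq y∈xs off on))
  (x+[e+r] (f x) e _)
  where
  x+[e+r] : ∀ x e r → x + (e + r) ≡ e + (x + r)
  x+[e+r] = solve-∀

∑-applyUpTo : ∀ (f g : ℕ → ℕ) n → ∑ (applyUpTo f n) g ≡ ∑ (upTo n) (g ∘ f)
∑-applyUpTo f g zero    = refl
∑-applyUpTo f g (suc n) = cong (g (f 0) +_)
  (trans (∑-applyUpTo (f ∘ suc) g n) (sym (∑-applyUpTo suc (g ∘ f) n)))

∑-upTo-suc : ∀ n f → ∑ (upTo (suc n)) f ≡ f 0 + ∑ (upTo n) (f ∘ suc)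
∑-upTo-suc n f = cong (f 0 +_) (∑-applyUpTo suc f n)

count-< : ∀ n s → s ≤ n → ∑ (upTo n) (λ j → ⟦ j <? s ⟧) ≡ s
count-< n       zero    _         = ∑-0 (upTo n)
count-< (suc n) (suc s) (s≤s s≤n) =
  trans (∑-upTo-suc n (λ j → ⟦ j <? suc s ⟧)) (cong suc (count-< n s s≤n))

-- Adding one unit at a single point

bump : ℕ → (ℕ → ℕ) → ℕ → ℕ
bump y s z = ⟦ y ≟ z ⟧ + s z

bump-at : ∀ y s → bump y s y ≡ suc (s y)
bump-at y s = cong (_+ s y) (⟦⟧-true (y ≟ y) refl)

bump-off : ∀ {y z} s → z ≢ y → bump y s z ≡ s z
bump-off {y} {z} s z≢y = cong (_+ s z) (⟦⟧-false (y ≟ z) (z≢y ∘ sym))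

bump-<? : ∀ e i → ⟦ i <? suc e ⟧ ≡ bump e (λ j → ⟦ j <? e ⟧) i
bump-<? e i with <-cmp i e
... | tri< i<e i≢e _ = trans (⟦⟧-true (i <? suc e) (m<n⇒m<1+n i<e))
  (sym (trans (bump-off (λ j → ⟦ j <? e ⟧) i≢e) (⟦⟧-true (i <? e) i<e)))
... | tri≈ i≮e refl _ = trans (⟦⟧-true (i <? suc i) ≤-refl)
  (sym (trans (bump-at i (λ j → ⟦ j <? i ⟧)) (cong suc (⟦⟧-false (i <? i) i≮e))))
... | tri> i≮e i≢e e<i = trans (⟦⟧-false (i <? suc e) (≤⇒≯ e<i))
  (sym (trans (bump-off (λ j → ⟦ j <? e ⟧) i≢e) (⟦⟧-false (i <? e) i≮e)))

∑-bump : ∀ {xs s y} → Unique xs → y ∈ xs → (g : ℕ → ℕ → ℕ) (e : ℕ) →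
         g y (suc (s y)) ≡ e + g y (s y) →
         ∑ xs (λ x → g x (bump y s x)) ≡ e + ∑ xs (λ x → g x (s x))
∑-bump {s = s} {y} uniq y∈xs g e eq = ∑-update e uniq y∈xs
  (λ x x≢y → cong (g x) (bump-off s x≢y)) (trans (cong (g y) (bump-at y s)) eq)

-- Group sizes and the effect of a move

size : ∀ {p} → State p → ℕ → ℕ
size {p} c z = ∑ (allFin p) λ v → ⟦ c v ≟ z ⟧

other : ∀ {p} → State p → Fin p → ℕ → Fin p → ℕ
other c u z v = if does (v ≟ᶠ u) then 0 else ⟦ c v ≟ z ⟧

others : ∀ {p} → State p → Fin p → ℕ → ℕ
others {p} c u z = ∑ (allFin p) (other c u z)

-- Separates the mover from the rest: a deviation leaves `others` alone, so the sizes before and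
-- after are this one function bumped at two colours.
size-others : ∀ {p} (c : State p) u z → size c z ≡ bump (c u) (others c u) z
size-others {p} c u z = ∑-update ⟦ c u ≟ z ⟧ (allFin⁺ p) (∈-allFin u) off on
  where
  off : ∀ v → v ≢ u → ⟦ c v ≟ z ⟧ ≡ other c u z v
  off v v≢u with v ≟ᶠ u
  ... | yes v≡u = ⊥-elim (v≢u v≡u)
  ... | no _    = refl
  on : ⟦ c u ≟ z ⟧ ≡ ⟦ c u ≟ z ⟧ + other c u z u
  on with u ≟ᶠ u
  ... | yes _  = sym (+-identityʳ _)
  ... | no u≢u = ⊥-elim (u≢u refl)

others-cong : ∀ {p} (c c′ : State p) u → (∀ v → v ≢ u → c v ≡ c′ v) → ∀ z → others c u z ≡ others c′ u z
others-cong {p} c c′ u eq z = ∑-cong (allFin p) same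
  where
  same : ∀ v → other c u z v ≡ other c′ u z v
  same v with v ≟ᶠ u
  ... | yes _  = refl
  ... | no v≢u = cong (λ x → ⟦ x ≟ z ⟧) (eq v v≢u)

others≤ : ∀ {p} (c : State p) u z → others c u z ≤ p
others≤ {p} c u z = ≤-trans (∑-≤length (allFin p) bound) (≤-reflexive (length-tabulate id))
  where
  bound : ∀ v → other c u z v ≤ 1
  bound v with v ≟ᶠ u
  ... | yes _ = z≤n
  ... | no _  = ⟦⟧≤1 (c v ≟ z)

move-at : ∀ {p} (c : State p) u j → move c u j u ≡ j
move-at c u j with u ≟ᶠ u
... | yes _  = refl
... | no u≢u = ⊥-elim (u≢u refl)

move-off : ∀ {p} (c : State p) u j v → v ≢ u → move c u j v ≡ c v
move-off c u j v v≢u with v ≟ᶠ u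
... | yes v≡u = ⊥-elim (v≢u v≡u)
... | no _    = refl

-- Utilities and deviations when all groups are cliques

module _ {p} (G : Game p) where
  open Game G using (w)

  -- The step function of utility is local to its definition; this gives it a name.
  utility-foldr : ∀ c u → Σ (Fin p → ℤ∞ → ℤ∞) λ f → utility G c u ≡ foldr f (fin (ℤ.+ 0)) (allFin p)
  utility-foldr c u = _ , refl

  private
    stepᵘ : State p → Fin p → Fin p → ℤ∞ → ℤ∞
    stepᵘ c u = proj₁ (utility-foldr c u)

  Mates : State p → Fin p → Set
  Mates c u = ∀ v → v ≢ u → c v ≡ c u → w u v ≡ fin (ℤ.+ 1)

  Cliques : State p → Set
  Cliques c = ∀ u → Mates c u

  -- Each other member of the group adds weight 1, so comparing utilities amounts to comparing group
  -- sizes.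
  utility-clique : ∀ c u → Mates c u → utility G c u ≡ fin (ℤ.+ others c u (c u))
  utility-clique c u mates = go (allFin p)
    where
    one : ∀ v n → stepᵘ c u v (fin (ℤ.+ n)) ≡ fin (ℤ.+ (other c u (c u) v + n))
    one v n with v ≟ᶠ u | c v ≟ c u
    ... | yes _  | _      = refl
    ... | no v≢u | yes eq rewrite mates v v≢u eq = cong (λ k → fin (ℤ.+ (k + n))) (sym (⟦⟧-true (c v ≟ c u) eq))
    ... | no _   | no ne  = cong (λ k → fin (ℤ.+ (k + n))) (sym (⟦⟧-false (c v ≟ c u) ne))
    go : ∀ vs → foldr (stepᵘ c u) (fin (ℤ.+ 0)) vs ≡ fin (ℤ.+ ∑ vs (other c u (c u)))
    go []       = refl
    go (v ∷ vs) = trans (cong (stepᵘ c u v) (go vs)) (one v _)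

  utility-infinite : ∀ c u v → v ≢ u → c v ≡ c u → w u v ≡ -∞ → utility G c u ≡ -∞
  utility-infinite c u v v≢u eq wuv≡-∞ = go (∈-allFin v)
    where
    absorb : ∀ x → stepᵘ c u x -∞ ≡ -∞
    absorb x with x ≟ᶠ u | c x ≟ c u
    ... | yes _ | _     = refl
    ... | no _  | no _  = refl
    ... | no _  | yes _ with w u x
    ...   | -∞    = refl
    ...   | fin _ = refl
    hit : ∀ acc → stepᵘ c u v acc ≡ -∞
    hit acc with v ≟ᶠ u | c v ≟ c u
    ... | yes v≡u | _     = ⊥-elim (v≢u v≡u)
    ... | no _    | no ne = ⊥-elim (ne eq)
    ... | no _    | yes _ rewrite wuv≡-∞ = refl
    go : ∀ {vs} → v ∈ vs → foldr (stepᵘ c u) (fin (ℤ.+ 0)) vs ≡ -∞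
    go (here refl)          = hit _
    go {x ∷ _} (there v∈vs) = trans (cong (stepᵘ c u x) (go v∈vs)) (absorb x)

  not<-∞ : ∀ {a b} → b ≡ -∞ → ¬ (a <∞ b)
  not<-∞ () -∞<fin
  not<-∞ () (fin<fin _)

  fin-cancel : ∀ {m n} → fin (ℤ.+ m) <∞ fin (ℤ.+ n) → m < n
  fin-cancel (fin<fin (ℤ.+<+ m<n)) = m<n

  module _ (uniform : Uniform G) {c c′ : State p} {u j}
           (moved : ∀ v → c′ v ≡ move c u j v)
           (improves : utility G c u <∞ utility G c′ u)
           where

    moved-off : ∀ v → v ≢ u → c v ≡ c′ v
    moved-off v v≢u = sym (trans (moved v) (move-off c u j v v≢u))

    moved-at : c′ u ≡ j
    moved-at = trans (moved u) (move-at c u j)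

    -- A weight `-∞` to a member of the new group would make the new utility `-∞`, which exceeds
    -- nothing.
    mates-deviator : Mates c′ u
    mates-deviator v v≢u eq with uniform u v (v≢u ∘ sym)
    ... | inj₁ -∞! = ⊥-elim (not<-∞ (utility-infinite c′ u v v≢u eq -∞!) improves)
    ... | inj₂ one = one

    cliques-deviation : Cliques c → Cliques c′
    cliques-deviation cliques x v v≢x eq with x ≟ᶠ u | v ≟ᶠ u
    ... | yes refl | _        = mates-deviator v v≢x eq
    ... | no x≢u   | yes refl = trans (Game.sym G x u) (mates-deviator x x≢u (sym eq))
    ... | no x≢u   | no v≢u   = cliques x v v≢x
      (trans (moved-off v v≢u) (trans eq (sym (moved-off x x≢u))))

    others-deviation : Cliques c → others c u (c u) < others c u j
    others-deviation cliques = subst (others c u (c u) <_)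
      (trans (cong (others c′ u) moved-at) (sym (others-cong c c′ u moved-off j)))
      (fin-cancel (subst₂ _<∞_ (utility-clique c u (cliques u))
        (utility-clique c′ u mates-deviator) improves))

    size-deviation : ∀ z → size c′ z ≡ bump j (others c u) z
    size-deviation z = trans (size-others c′ u z)
      (cong₂ _+_ (cong (λ x → ⟦ x ≟ z ⟧) moved-at) (sym (others-cong c c′ u moved-off z)))

-- The Young diagram of the group sizes, by column heights

column : ℕ → (ℕ → ℕ) → ℕ → ℕ
column B s j = ∑ (upTo B) λ x → ⟦ j <? s x ⟧

-- The row of colour `y` grows at its end, so the new cell lies in column `s y`.
column-bump : ∀ {B y} s → y < B → ∀ j → column B (bump y s) j ≡ bump (s y) (column B s) j
column-bump {B} {y} s y<B j =
  ∑-bump (upTo⁺ B) (∈-upTo⁺ y<B) (λ _ z → ⟦ j <? z ⟧) ⟦ s y ≟ j ⟧ (bump-<? (s y) j)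

column-antitone : ∀ {B s i j} → i ≤ j → column B s j ≤ column B s i
column-antitone {B} {s} {i} {j} i≤j =
  ∑-mono (upTo B) λ x → ⟦⟧-mono (j <? s x) (i <? s x) (≤-<-trans i≤j)

-- Row `y` has a cell in column `i` but none in column `s y`. This is why the moving cell also goes
-- upwards.
column-strict : ∀ {B s i y} → y < B → i < s y → column B s (s y) < column B s i
column-strict {B} {s} {i} {y} y<B i<sy = ∑-strict
  (λ x → ⟦⟧-mono (s y <? s x) (i <? s x) (<-trans i<sy))
  (∈-upTo⁺ y<B)
  (subst₂ _<_ (sym (⟦⟧-false (s y <? s y) (<-irrefl refl))) (sym (⟦⟧-true (i <? s y) i<sy)) ≤-refl)

column≤ : ∀ B s j → column B s j ≤ B
column≤ B s j = ≤-trans (∑-≤length (upTo B) λ x → ⟦⟧≤1 (j <? s x)) (≤-reflexive (length-upTo B))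

-- Double counting of the cells by columns, by rows and by players; a player counts once if its
-- colour is below `B`, and otherwise not at all.
∑-column : ∀ {p} (c : State p) B N → (∀ z → size c z ≤ N) → ∑ (upTo N) (column B (size c)) ≤ p
∑-column {p} c B N size≤N = begin
  ∑ (upTo N) (column B (size c))                             ≡⟨ ∑-swap (upTo N) (upTo B) (λ j x → ⟦ j <? size c x ⟧) ⟩
  ∑ (upTo B) (λ x → ∑ (upTo N) (λ j → ⟦ j <? size c x ⟧))    ≡⟨ ∑-cong (upTo B) (λ x → count-< N (size c x) (size≤N x)) ⟩
  ∑ (upTo B) (size c)                                        ≡⟨ ∑-swap (upTo B) (allFin p) (λ x v → ⟦ c v ≟ x ⟧) ⟩
  ∑ (allFin p) (λ v → ∑ (upTo B) (λ x → ⟦ c v ≟ x ⟧))        ≤⟨ ∑-≤length (allFin p) (λ v → count-≡ (c v)) ⟩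
  length (allFin p)                                          ≡⟨ length-tabulate id ⟩
  p                                                          ∎
  where
  open ≤-Reasoning
  count-≡ : ∀ y → ∑ (upTo B) (λ x → ⟦ y ≟ x ⟧) ≤ 1
  count-≡ y with y <? B
  ... | yes y<B = ≤-reflexive (trans
    (∑-update {f = λ _ → 0} 1 (upTo⁺ B) (∈-upTo⁺ y<B)
      (λ x x≢y → ⟦⟧-false (y ≟ x) (x≢y ∘ sym)) (⟦⟧-true (y ≟ y) refl))
    (cong suc (∑-0 (upTo B))))
  ... | no y≮B = ≤-trans (≤-reflexive (trans
    (∑-cong-∈ (upTo B) λ x∈ → ⟦⟧-false (y ≟ _) λ { refl → y≮B (∈-upTo⁻ x∈) })
    (∑-0 (upTo B)))) z≤n

-- For a partition with column heights h: cells below row k, and cells right of column l.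
below right : ℕ → (ℕ → ℕ) → ℕ → ℕ
below N h k = ∑ (upTo N) λ j → h j ∸ k
right N h l = ∑ (upTo N) λ j → ⟦ l ≤? j ⟧ * h j

-- The cell added to column `y` lands in row `h y`, counted from 0.
below-bump : ∀ {N h y} → y < N → ∀ k → below N (bump y h) k ≡ ⟦ k ≤? h y ⟧ + below N h k
below-bump {N} {h} {y} y<N k =
  ∑-bump (upTo⁺ N) (∈-upTo⁺ y<N) (λ _ z → z ∸ k) ⟦ k ≤? h y ⟧ (suc-∸ (h y) k)
  where
  suc-∸ : ∀ z k → suc z ∸ k ≡ ⟦ k ≤? z ⟧ + (z ∸ k)
  suc-∸ z k with k ≤? z
  ... | yes k≤z = trans (+-∸-assoc 1 k≤z) (cong (_+ (z ∸ k)) (sym (⟦⟧-true (k ≤? z) k≤z)))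
  ... | no k≰z  = trans (m≤n⇒m∸n≡0 (≰⇒> k≰z))
    (sym (cong₂ _+_ (⟦⟧-false (k ≤? z) k≰z) (m≤n⇒m∸n≡0 (<⇒≤ (≰⇒> k≰z)))))

right-bump : ∀ {N h y} → y < N → ∀ l → right N (bump y h) l ≡ ⟦ l ≤? y ⟧ + right N h l
right-bump {N} {h} {y} y<N l =
  ∑-bump (upTo⁺ N) (∈-upTo⁺ y<N) (λ j z → ⟦ l ≤? j ⟧ * z) ⟦ l ≤? y ⟧ (*-suc ⟦ l ≤? y ⟧ (h y))

-- The height conditions put the whole `k` by `l` rectangle inside the diagram and leave no cell
-- both below row `k` and right of column `l`.
below+right : ∀ {N h} → ∀ k l → l ≤ N →
              (∀ {j} → j < l → k ≤ h j) → (∀ {j} → l ≤ j → h j ≤ k) →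
              l * k + (below N h k + right N h l) ≡ ∑ (upTo N) h
below+right {N} {h} k l l≤N tall short = begin
  l * k + (below N h k + right N h l)
    ≡⟨ cong₂ _+_ (trans (cong (_* k) (sym (count-< N l l≤N))) (sym (∑-*ʳ (upTo N) _ k))) (sym (∑-+ (upTo N) _ _)) ⟩
  ∑ (upTo N) (λ j → ⟦ j <? l ⟧ * k) + ∑ (upTo N) (λ j → (h j ∸ k) + ⟦ l ≤? j ⟧ * h j)
    ≡⟨ sym (∑-+ (upTo N) _ _) ⟩
  ∑ (upTo N) (λ j → ⟦ j <? l ⟧ * k + ((h j ∸ k) + ⟦ l ≤? j ⟧ * h j))
    ≡⟨ ∑-cong (upTo N) split ⟩
  ∑ (upTo N) h ∎
  where
  open ≡-Reasoning
  split : ∀ j → ⟦ j <? l ⟧ * k + ((h j ∸ k) + ⟦ l ≤? j ⟧ * h j) ≡ h j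
  split j with j <? l
  ... | yes j<l rewrite ⟦⟧-true (j <? l) j<l | ⟦⟧-false (l ≤? j) (<⇒≱ j<l) =
    trans (cong₂ _+_ (+-identityʳ k) (+-identityʳ _)) (m+[n∸m]≡n (tall j<l))
  ... | no j≮l rewrite ⟦⟧-false (j <? l) j≮l | ⟦⟧-true (l ≤? j) (≮⇒≥ j≮l) =
    cong₂ _+_ (m≤n⇒m∸n≡0 (short (≮⇒≥ j≮l))) (+-identityʳ (h j))

-- The two truncated potentials

module Potential (n B N : ℕ) (x y : ℕ → ℕ) (cover : ∀ k l → n ≤ l * k + (x k + y l)) where

  -- Truncation by `x` and `y` caps the total change over a run. Index 0 is left out: there both
  -- counts are the number of all cells, which is constant.
  U W : (ℕ → ℕ) → ℕ
  U h = ∑ (upTo B) λ k → below N h (suc k) ⊓ x (suc k)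
  W h = ∑ (upTo N) λ l → right N h (suc l) ⊓ y (suc l)

  U-cong : ∀ {h h′} → (∀ j → h j ≡ h′ j) → U h ≡ U h′
  U-cong h≗h′ = ∑-cong (upTo B) λ k → cong (_⊓ x (suc k)) (∑-cong (upTo N) λ j → cong (_∸ suc k) (h≗h′ j))

  W-cong : ∀ {h h′} → (∀ j → h j ≡ h′ j) → W h ≡ W h′
  W-cong h≗h′ = ∑-cong (upTo N) λ l → cong (_⊓ y (suc l)) (∑-cong (upTo N) λ j → cong (⟦ suc l ≤? j ⟧ *_) (h≗h′ j))

  W≤ : ∀ h → W h ≤ ∑ (upTo N) (λ l → y (suc l))
  W≤ h = ∑-mono (upTo N) λ l → m⊓n≤n _ (y (suc l))

  U≤ : ∀ h → U h ≤ ∑ (upTo B) (λ k → x (suc k))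
  U≤ h = ∑-mono (upTo B) λ k → m⊓n≤n _ (x (suc k))

  -- `h` is the diagram without the moving cell, which ends column `a` before the step (`h⁻`) and
  -- column `b` after it (`h⁺`).
  module _ {h : ℕ → ℕ} {a b : ℕ} (antitone : ∀ {i j} → i ≤ j → h j ≤ h i)
           (a<b : a < b) (b<N : b < N) (hb<ha : h b < h a) (ha≤B : h a ≤ B)
           (total : ∑ (upTo N) (bump a h) ≤ n)
           where

    private
      a<N : a < N
      a<N = <-trans a<b b<N

      h⁻ h⁺ : ℕ → ℕ
      h⁻ = bump a h
      h⁺ = bump b h

    below-mono : ∀ k → below N h⁺ k ≤ below N h⁻ k
    below-mono k = subst₂ _≤_ (sym (below-bump b<N k)) (sym (below-bump a<N k))
      (+-monoˡ-≤ _ (⟦⟧-mono (k ≤? h b) (k ≤? h a) λ k≤hb → ≤-trans k≤hb (<⇒≤ hb<ha)))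

    right-mono : ∀ l → right N h⁻ l ≤ right N h⁺ l
    right-mono l = subst₂ _≤_ (sym (right-bump a<N l)) (sym (right-bump b<N l))
      (+-monoˡ-≤ _ (⟦⟧-mono (l ≤? a) (l ≤? b) λ l≤a → ≤-trans l≤a (<⇒≤ a<b)))

    below-strict : below N h⁺ (h a) < below N h⁻ (h a)
    below-strict = subst₂ _<_
      (sym (trans (below-bump b<N (h a)) (cong (_+ below N h (h a)) (⟦⟧-false (h a ≤? h b) (<⇒≱ hb<ha)))))
      (sym (trans (below-bump a<N (h a)) (cong (_+ below N h (h a)) (⟦⟧-true (h a ≤? h a) ≤-refl))))
      ≤-refl

    right-strict : right N h⁻ (suc a) < right N h⁺ (suc a)
    right-strict = subst₂ _<_
      (sym (trans (right-bump a<N (suc a)) (cong (_+ right N h (suc a)) (⟦⟧-false (suc a ≤? a) (<-irrefl refl)))))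
      (sym (trans (right-bump b<N (suc a)) (cong (_+ right N h (suc a)) (⟦⟧-true (suc a ≤? b) a<b))))
      ≤-refl

    U-mono : U h⁺ ≤ U h⁻
    U-mono = ∑-mono (upTo B) λ k → ⊓-monoˡ-≤ (x (suc k)) (below-mono (suc k))

    W-mono : W h⁻ ≤ W h⁺
    W-mono = ∑-mono (upTo N) λ l → ⊓-monoˡ-≤ (y (suc l)) (right-mono (suc l))

    U-strict : below N h⁻ (h a) ≤ x (h a) → U h⁺ < U h⁻
    U-strict below≤x = at (h a) refl
      where
      -- `U` starts at row 1, and `h a` is positive because `h b < h a`.
      at : ∀ k → k ≡ h a → U h⁺ < U h⁻
      at zero    eq = ⊥-elim (n≮0 (subst (h b <_) (sym eq) hb<ha))
      at (suc k) eq = ∑-strict (λ k′ → ⊓-monoˡ-≤ (x (suc k′)) (below-mono (suc k′)))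
        (∈-upTo⁺ (subst (_≤ B) (sym eq) ha≤B))
        (subst (λ k′ → below N h⁺ k′ ⊓ x k′ < below N h⁻ k′ ⊓ x k′) (sym eq)
          (subst (below N h⁺ (h a) ⊓ x (h a) <_) (sym (m≤n⇒m⊓n≡m below≤x))
            (m<n⇒m⊓o<n _ below-strict)))

    W-strict : right N h⁻ (suc a) < y (suc a) → W h⁻ < W h⁺
    W-strict right<y = ∑-strict (λ l → ⊓-monoˡ-≤ (y (suc l)) (right-mono (suc l))) (∈-upTo⁺ a<N)
      (≤-<-trans (m⊓n≤m _ _) (⊓-glb right-strict right<y))

    -- The row `h a` is that of the moving cell, so the cell itself counts as below; `suc a` is the
    -- first column to its right.
    corner : suc a * h a + (below N h⁻ (h a) + right N h⁻ (suc a)) ≤ n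
    corner = ≤-trans (≤-reflexive (below+right (h a) (suc a) a<N
      (λ { {j} (s≤s j≤a) → ≤-trans (antitone j≤a) (m≤n+m _ ⟦ a ≟ j ⟧) })
      (λ a<j → ≤-trans (≤-reflexive (bump-off {a} h λ { refl → <-irrefl refl a<j })) (antitone (<⇒≤ a<j))))) total

    potential-step : suc (W h⁻ + U h⁺) ≤ W h⁺ + U h⁻
    potential-step with below N h⁻ (h a) ≤? x (h a) | right N h⁻ (suc a) <? y (suc a)
    ... | yes below≤x | _           = +-mono-≤-< W-mono (U-strict below≤x)
    ... | no _        | yes right<y = +-mono-<-≤ (W-strict right<y) U-mono
    -- With more than `x` cells below and at least `y` to the right, `cover` would give the diagram
    -- more than `n` cells.
    ... | no below≰x  | no right≮y  = ⊥-elim (<-irrefl refl (≤-<-trans (cover (h a) (suc a))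
      (<-≤-trans (+-monoʳ-< (suc a * h a) (+-mono-<-≤ (≰⇒> below≰x) (≮⇒≥ right≮y))) corner)))

-- The upper bound for an arbitrary run

colours : ∀ {p} {G : Game p} {c ℓ} → Run G c ℓ → ℕ
colours done                     = 0
colours (step (_ , j , _) moves) = suc j ⊔ colours moves

module _ {n p : ℕ} (G : Game p) (uniform : Uniform G) (p≤n : p ≤ n)
         (x y : ℕ → ℕ) (cover : ∀ k l → n ≤ l * k + (x k + y l)) (B : ℕ) where

  private N = suc p

  open Potential n B N x y cover

  -- In subtraction-free form: the remaining steps are paid by what `U` can still lose and what `W`
  -- can still gain, `W` being capped by the sum of `y`.
  run≤potential : ∀ {c ℓ} → Cliques G c → (∀ v → c v < B) → (run : Run G c ℓ) → colours run ≤ B →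
                  ℓ + W (column B (size c)) ≤ U (column B (size c)) + ∑ (upTo N) (λ l → y (suc l))
  run≤potential {c} cliques c<B done run≤B = ≤-trans (W≤ (column B (size c))) (m≤n+m _ (U (column B (size c))))
  run≤potential {c} {suc ℓ} cliques c<B (step {c' = c′} (u , j , moved , improves) moves) run≤B =
    -- The gain of this step is added to the inductive bound, and the potentials of the next state
    -- cancel.
    +-cancelʳ-≤ (W h′ + U h′) _ _ (subst₂ _≤_
      (shuffle₁ ℓ (W h) (W h′) (U h′))
      (shuffle₂ (U h) (W h′) (U h′) _)
      (+-mono-≤ decrease
        (run≤potential (cliques-deviation G uniform moved improves cliques) c′<B moves
          (≤-trans (m≤n⊔m (suc j) (colours moves)) run≤B))))
    where
    shuffle₁ : ∀ ℓ w w′ u′ → suc (w + u′) + (ℓ + w′) ≡ suc ℓ + w + (w′ + u′)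
    shuffle₁ = solve-∀
    shuffle₂ : ∀ u w′ u′ y → w′ + u + (u′ + y) ≡ u + y + (w′ + u′)
    shuffle₂ = solve-∀
    h h′ h₁ s : ℕ → ℕ
    h = column B (size c)
    h′ = column B (size c′)
    s = others c u
    h₁ = column B s
    j<B : j < B
    j<B = ≤-trans (m≤m⊔n (suc j) (colours moves)) run≤B
    c′<B : ∀ v → c′ v < B
    c′<B v with v ≟ᶠ u
    ... | yes refl = subst (_< B) (sym (moved-at G uniform {c} moved improves)) j<B
    ... | no v≢u   = subst (_< B) (moved-off G uniform {c} moved improves v v≢u) (c<B v)
    column-cong : ∀ {s s′} → (∀ z → s z ≡ s′ z) → ∀ i → column B s i ≡ column B s′ i
    column-cong eq i = ∑-cong (upTo B) λ z → cong (λ k → ⟦ i <? k ⟧) (eq z)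
    h≗ : ∀ i → h i ≡ bump (s (c u)) h₁ i
    h≗ i = trans (column-cong (size-others c u) i) (column-bump s (c<B u) i)
    h′≗ : ∀ i → h′ i ≡ bump (s j) h₁ i
    h′≗ i = trans (column-cong (size-deviation G uniform moved improves) i) (column-bump s j<B i)
    size≤N : ∀ z → size c z ≤ N
    size≤N z = ≤-trans (≤-reflexive (size-others c u z)) (+-mono-≤ (⟦⟧≤1 (c u ≟ z)) (others≤ c u z))
    a<b : s (c u) < s j
    a<b = others-deviation G uniform moved improves cliques
    decrease : suc (W h + U h′) ≤ W h′ + U h
    decrease rewrite W-cong h≗ | W-cong h′≗ | U-cong h≗ | U-cong h′≗ =
      potential-step (column-antitone {B} {s}) a<b (s≤s (others≤ c u j)) (column-strict {s = s} j<B a<b) (column≤ B s _)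
        (≤-trans (≤-reflexive (∑-cong (upTo N) (λ i → sym (h≗ i)))) (≤-trans (∑-column c B N size≤N) p≤n))

-- The cost of a partition, and of the staircase

C2-suc : ∀ n → suc n C 2 ≡ n + n C 2
C2-suc n = trans (sym (nCk+nC[k+1]≡[n+1]C[k+1] n 1)) (cong (_+ n C 2) (nC1≡n n))

C3-suc : ∀ n → suc n C 3 ≡ n C 2 + n C 3
C3-suc n = sym (nCk+nC[k+1]≡[n+1]C[k+1] n 2)

-- Cells in row i and column j (from 0) of a partition ρ contribute i + j.
cost : List ℕ → ℕ
cost []      = 0
cost (a ∷ ρ) = a C 2 + (sum ρ + cost ρ)

-- Each of the first `k` rows has at most `l` cells besides those right of column `l`; the later
-- rows are counted whole.
rows-cover : ∀ ρ k l → sum ρ ≤ l * k + (sum (drop k ρ) + ∑ ρ (_∸ l))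
rows-cover []      k       l = z≤n
rows-cover (a ∷ ρ) zero    l = ≤-trans (m≤m+n _ _) (m≤n+m _ (l * 0))
rows-cover (a ∷ ρ) (suc k) l = ≤-trans (+-mono-≤ (m≤n+m∸n a l) (rows-cover ρ k l))
  (≤-reflexive (rearrange l k (a ∸ l) (sum (drop k ρ)) _))
  where
  rearrange : ∀ l k d x y → l + d + (l * k + (x + y)) ≡ l * suc k + (x + (d + y))
  rearrange = solve-∀

row-tails : List ℕ → ℕ
row-tails []      = 0
row-tails (_ ∷ ρ) = sum ρ + row-tails ρ

∑-drop : ∀ B ρ → ∑ (upTo B) (λ k → sum (drop (suc k) ρ)) ≤ row-tails ρ
∑-drop B       []      = ≤-reflexive (∑-0 (upTo B))
∑-drop zero    (a ∷ ρ) = z≤n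
∑-drop (suc B) (a ∷ ρ) = ≤-trans (≤-reflexive (∑-upTo-suc B (λ k → sum (drop k ρ))))
  (+-monoʳ-≤ (sum ρ) (∑-drop B ρ))

∑-∸ : ∀ N a → ∑ (upTo N) (λ l → a ∸ suc l) ≤ a C 2
∑-∸ N       zero    = ≤-reflexive (∑-0 (upTo N))
∑-∸ zero    (suc a) = z≤n
∑-∸ (suc N) (suc a) = ≤-trans (≤-reflexive (∑-upTo-suc N (λ l → a ∸ l)))
  (≤-trans (+-monoʳ-≤ a (∑-∸ N a)) (≤-reflexive (sym (C2-suc a))))

-- A cell in row `i` lies in exactly `i` of the tails, and `a C 2` adds up the column indices of a
-- row of length `a`.
cost-split : ∀ ρ → row-tails ρ + ∑ ρ (_C 2) ≡ cost ρ
cost-split []      = refl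
cost-split (a ∷ ρ) = trans (rearrange (sum ρ) (row-tails ρ) (a C 2) _) (cong (λ z → a C 2 + (sum ρ + z)) (cost-split ρ))
  where
  rearrange : ∀ s t c d → s + t + (c + d) ≡ c + (s + (t + d))
  rearrange = solve-∀

cliques-singletons : ∀ {p} (G : Game p) → Cliques G singletons
cliques-singletons G u v v≢u eq = ⊥-elim (v≢u (toℕ-injective eq))

run≤cost : ∀ {p} (G : Game p) → Uniform G → ∀ ρ → p ≤ sum ρ → ∀ {ℓ} → Run G singletons ℓ → ℓ ≤ cost ρ
run≤cost {p} G uniform ρ p≤n {ℓ} run = begin
  ℓ                        ≤⟨ m≤m+n ℓ _ ⟩
  ℓ + W h                  ≤⟨ run≤potential G uniform p≤n x y (rows-cover ρ) B (cliques-singletons G)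
                                (λ v → <-≤-trans (toℕ<n v) (m≤m+n p _)) run (m≤n+m _ p) ⟩
  U h + ∑ (upTo N) (λ l → y (suc l))
                           ≤⟨ +-mono-≤ (≤-trans (U≤ h) (∑-drop B ρ))
                                (≤-trans (≤-reflexive (∑-swap (upTo N) ρ (λ l a → a ∸ suc l))) (∑-mono ρ (∑-∸ N))) ⟩
  row-tails ρ + ∑ ρ (_C 2) ≡⟨ cost-split ρ ⟩
  cost ρ                   ∎
  where
  open ≤-Reasoning
  x y h : ℕ → ℕ
  x k = sum (drop k ρ)
  y l = ∑ ρ (_∸ l)
  B N : ℕ
  -- The summand `p` covers the colours of the singletons, the other one every colour entered later,
  -- which may be any number.
  B = p + colours run
  N = suc p
  h = column B (size {p} singletons)
  open Potential (sum ρ) B N x y (rows-cover ρ)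

-- The optimal partition: a staircase m, m ∸ 1, …, 1 with its first r rows extended by one cell.
stair : ℕ → ℕ → List ℕ
stair zero    _       = []
stair (suc m) zero    = suc m ∷ stair m 0
stair (suc m) (suc r) = suc (suc m) ∷ stair m r

sum-stair : ∀ m r → r ≤ m → sum (stair m r) ≡ suc m C 2 + r
sum-stair zero    .0      z≤n       = refl
sum-stair (suc m) zero    _         = trans (cong (suc m +_) (sum-stair m 0 z≤n))
  (trans (sym (+-assoc (suc m) _ 0)) (cong (_+ 0) (sym (C2-suc (suc m)))))
sum-stair (suc m) (suc r) (s≤s r≤m) = trans (cong (suc (suc m) +_) (sum-stair m r r≤m))
  (trans (rearrange m (suc m C 2) r) (cong (_+ suc r) (sym (C2-suc (suc m)))))
  where
  rearrange : ∀ m c r → suc (suc m) + (c + r) ≡ suc m + c + suc r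
  rearrange = solve-∀

-- A new first row pushes the smaller staircase down by one row, which costs one per cell; hence the
-- use of `sum-stair`.
cost-stair : ∀ m r → r ≤ m → cost (stair m r) ≡ 2 * (suc m C 3) + m * r
cost-stair zero    .0      z≤n       = refl
cost-stair (suc m) zero    _
  rewrite sum-stair m 0 z≤n | cost-stair m 0 z≤n | C3-suc (suc m) = rearrange m (suc m C 2) (suc m C 3)
  where
  rearrange : ∀ m t q → t + (t + 0 + (2 * q + m * 0)) ≡ 2 * (t + q) + suc m * 0
  rearrange = solve-∀
cost-stair (suc m) (suc r) (s≤s r≤m)
  rewrite sum-stair m r r≤m | cost-stair m r r≤m | C3-suc (suc m) | C2-suc (suc m) =
    rearrange m r (suc m C 2) (suc m C 3)
  where
  rearrange : ∀ m r t q → suc m + t + (t + r + (2 * q + m * r)) ≡ 2 * (t + q) + suc m * suc r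
  rearrange = solve-∀

-- Size profiles for the lower bound

-- Groups of sizes q, q ∸ 1, …, 1, the first t of them enlarged by one player, then singletons up to colour e.
H : ℕ → ℕ → ℕ → ℕ → ℕ
H q t e i = ((q ∸ i) + ⟦ i <? t ⟧) ⊔ ⟦ i <? e ⟧

H-group : ∀ {q t e i} → t ≤ i → i < q → H q t e i ≡ q ∸ i
H-group {q} {t} {e} {i} t≤i i<q = trans
  (cong (_⊔ ⟦ i <? e ⟧) (trans (cong (q ∸ i +_) (⟦⟧-false (i <? t) (≤⇒≯ t≤i))) (+-identityʳ _)))
  (m≥n⇒m⊔n≡m (≤-trans (⟦⟧≤1 (i <? e)) (m<n⇒0<n∸m i<q)))

H-beyond : ∀ {q t e i} → t ≤ i → q ≤ i → H q t e i ≡ ⟦ i <? e ⟧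
H-beyond {q} {t} {e} {i} t≤i q≤i =
  cong (_⊔ ⟦ i <? e ⟧) (cong₂ _+_ (m≤n⇒m∸n≡0 q≤i) (⟦⟧-false (i <? t) (≤⇒≯ t≤i)))

H-empty : ∀ {q t e} → t ≤ e → q ≤ e → H q t e e ≡ 0
H-empty {e = e} t≤e q≤e = trans (H-beyond {e = e} t≤e q≤e) (⟦⟧-false (e <? e) (<-irrefl refl))

H-decreasing : ∀ {q t e i} → t ≤ i → suc i < q → H q t e (suc i) < H q t e i
H-decreasing {q} {t} {e} {i} t≤i i+1<q = subst₂ _<_
  (sym (H-group {e = e} (m≤n⇒m≤1+n t≤i) i+1<q))
  (sym (H-group {e = e} t≤i (<-trans (n<1+n i) i+1<q)))
  (∸-monoʳ-< (n<1+n i) (<⇒≤ i+1<q))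

-- Colour `e` is still empty, so the added player is one more singleton; read backwards, it is the
-- singleton about to leave.
H-supply : ∀ {q t e} → t ≤ e → q ≤ e → ∀ i → bump e (H q t e) i ≡ H q t (suc e) i
H-supply {q} {t} {e} t≤e q≤e i with i ≟ e
... | yes refl = trans (bump-at e (H q t e)) (trans (cong suc (H-empty {q} t≤e q≤e))
  (sym (trans (H-beyond {e = suc e} t≤e q≤e) (⟦⟧-true (e <? suc e) ≤-refl))))
... | no i≢e = trans (bump-off (H q t e) i≢e) (cong ((q ∸ i) + ⟦ i <? t ⟧ ⊔_)
  (sym (trans (bump-<? e i) (bump-off (λ j → ⟦ j <? e ⟧) i≢e))))

H-enlarge : ∀ {q t e} → t < q → ∀ i → bump t (H q t e) i ≡ H q (suc t) e i
H-enlarge {q} {t} {e} t<q i with i ≟ t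
... | yes refl = trans (bump-at t (H q t e)) (trans (cong suc (H-group {e = e} ≤-refl t<q))
  (sym (trans (m≥n⇒m⊔n≡m (≤-trans (⟦⟧≤1 (t <? e)) (≤-trans (m<n⇒0<n∸m t<q) (m≤m+n _ _))))
    (trans (cong (q ∸ t +_) (⟦⟧-true (t <? suc t) ≤-refl)) (+-comm _ 1)))))
... | no i≢t = trans (bump-off (H q t e) i≢t) (cong (λ z → (q ∸ i) + z ⊔ ⟦ i <? e ⟧)
  (sym (trans (bump-<? t i) (bump-off (λ j → ⟦ j <? t ⟧) i≢t))))

-- Once all `q` groups are enlarged, the singleton of colour `q` serves as the last group of the
-- next staircase.
H-next : ∀ {q e} → q < e → ∀ i → H q q e i ≡ H (suc q) 0 e i
H-next {q} {e} q<e i with <-cmp i q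
... | tri< i<q _ _ = cong (_⊔ ⟦ i <? e ⟧) (trans (cong (q ∸ i +_) (⟦⟧-true (i <? q) i<q))
  (trans (+-comm _ 1) (trans (sym (+-∸-assoc 1 (<⇒≤ i<q))) (sym (+-identityʳ _)))))
... | tri≈ _ refl _ = trans (H-beyond {q} {q} {e} ≤-refl ≤-refl) (trans (⟦⟧-true (q <? e) q<e)
  (sym (trans (H-group {suc q} {0} {e} z≤n ≤-refl) (trans (+-∸-assoc 1 {q} ≤-refl) (cong suc (n∸n≡0 q))))))
... | tri> _ _ q<i = trans (H-beyond {q} {q} {e} (<⇒≤ q<i) (<⇒≤ q<i)) (sym (H-beyond {suc q} {0} {e} z≤n q<i))

-- The `k` players who have already joined the group of colour 0 are kept apart, so that `s` retains
-- its simple formula.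
heap : ℕ → (ℕ → ℕ) → ℕ → ℕ
heap k s zero    = k + s zero
heap k s (suc i) = s (suc i)

heap-cong : ∀ k {s s′} → (∀ i → s i ≡ s′ i) → ∀ i → heap k s i ≡ heap k s′ i
heap-cong k s≗s′ zero    = cong (k +_) (s≗s′ zero)
heap-cong k s≗s′ (suc i) = s≗s′ (suc i)

heap-0 : ∀ s i → s i ≡ heap 0 s i
heap-0 s zero    = refl
heap-0 s (suc i) = refl

heap-grow : ∀ k s i → heap (suc k) s i ≡ bump 0 (heap k s) i
heap-grow k s zero    = refl
heap-grow k s (suc i) = refl

heap-bump : ∀ k x s i → bump (suc x) (heap k s) i ≡ heap k (bump (suc x) s) i
heap-bump k x s zero    = refl
heap-bump k x s (suc i) = refl

heap-decreasing : ∀ {k s i} → s (suc i) < s i → heap k s (suc i) < heap k s i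
heap-decreasing {k} {i = zero}  s1<s0 = ≤-trans s1<s0 (m≤n+m _ k)
heap-decreasing     {i = suc i} lt    = lt

heap≥ : ∀ k s i → s i ≤ heap k s i
heap≥ k s zero    = m≤n+m _ k
heap≥ k s (suc i) = ≤-refl

-- Group sizes m, m ∸ 1, … for the colours below q, and a players of colour q.
V : ℕ → ℕ → ℕ → ℕ → ℕ
V m q a i = ⟦ i <? q ⟧ * (m ∸ i) + ⟦ q ≟ i ⟧ * a

V-group : ∀ {m q a i} → i < q → V m q a i ≡ m ∸ i
V-group {m} {q} {a} {i} i<q = trans
  (cong₂ (λ x y → x * (m ∸ i) + y * a) (⟦⟧-true (i <? q) i<q) (⟦⟧-false (q ≟ i) λ { refl → <-irrefl refl i<q }))
  (trans (+-identityʳ _) (+-identityʳ _))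

V-last : ∀ m q a → V m q a q ≡ a
V-last m q a = trans
  (cong₂ (λ x y → x * (m ∸ q) + y * a) (⟦⟧-false (q <? q) (<-irrefl refl)) (⟦⟧-true (q ≟ q) refl))
  (+-identityʳ a)

V-beyond : ∀ {m q a i} → q < i → V m q a i ≡ 0
V-beyond {m} {q} {a} {i} q<i =
  cong₂ (λ x y → x * (m ∸ i) + y * a) (⟦⟧-false (i <? q) (≤⇒≯ (<⇒≤ q<i))) (⟦⟧-false (q ≟ i) (<⇒≢ q<i))

V-bump : ∀ m q a i → bump q (V m q a) i ≡ V m q (suc a) i
V-bump m q a i = rearrange ⟦ q ≟ i ⟧ (⟦ i <? q ⟧ * (m ∸ i)) a
  where
  rearrange : ∀ δ x a → δ + (x + δ * a) ≡ x + δ * suc a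
  rearrange = solve-∀

V-next : ∀ m q i → V m q (m ∸ q) i ≡ V m (suc q) 0 i
V-next m q i with <-cmp i q
... | tri< i<q _ _  = trans (V-group i<q) (sym (V-group (m<n⇒m<1+n i<q)))
... | tri≈ _ refl _ = trans (V-last m q (m ∸ q)) (sym (V-group {m} {suc q} {0} ≤-refl))
... | tri> _ _ q<i  = trans (V-beyond {m} {a = m ∸ q} q<i) (sym (beyond (m≤n⇒m<n∨m≡n q<i)))
  where
  beyond : suc q < i ⊎ suc q ≡ i → V m (suc q) 0 i ≡ 0
  beyond (inj₁ q+1<i) = V-beyond {m} {a = 0} q+1<i
  beyond (inj₂ refl)  = V-last m (suc q) 0

V≗H : ∀ m i → V m m 0 i ≡ H m 0 m i
V≗H m i with <-cmp i m
... | tri< i<m _ _  = trans (V-group i<m) (sym (H-group {m} {0} {m} z≤n i<m))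
... | tri≈ _ refl _ = trans (V-last m m 0) (sym (H-empty {m} {0} {m} z≤n ≤-refl))
... | tri> i≮m _ m<i = trans (V-beyond {m} {a = 0} m<i)
  (sym (trans (H-beyond {m} {0} {m} z≤n (<⇒≤ m<i)) (⟦⟧-false (i <? m) i≮m)))

-- A longest run in the game with all weights 1

complete : ∀ n → Game n
complete n = record { w = λ _ _ → fin (ℤ.+ 1) ; sym = λ _ _ → refl }

module _ {n : ℕ} where

  utility-complete : ∀ c u → utility (complete n) c u ≡ fin (ℤ.+ others c u (c u))
  utility-complete c u = utility-clique (complete n) c u λ _ _ _ → refl

  -- Only sizes matter when all weights are 1. The lemmas below prepend moves, leading from later
  -- sizes back to earlier ones.
  Long : (ℕ → ℕ) → ℕ → Set
  Long s ℓ = ∀ (c : State n) → (∀ z → size c z ≡ s z) → Run (complete n) c ℓ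

  long-cong : ∀ {s s′ ℓ} → (∀ z → s z ≡ s′ z) → Long s ℓ → Long s′ ℓ
  long-cong s≗s′ long c eq = long c λ z → trans (eq z) (sym (s≗s′ z))

  long-step : ∀ s x y {ℓ} → s x < s y → Long (bump y s) ℓ → Long (bump x s) (suc ℓ)
  long-step s x y sx<sy long c eq
    with ∑-positive (allFin n) (subst (0 <_) (sym (trans (eq x) (bump-at x s))) z<s)
  ... | u , 0<⟦⟧ = step (u , y , (λ _ → refl) , improves) (long c′ sizes)
    where
    c′ : State n
    c′ = move c u y
    at : c u ≡ x
    at with c u ≟ x
    ... | yes cu≡x = cu≡x
    ... | no cu≢x  = ⊥-elim (n≮0 (subst (0 <_) (⟦⟧-false (c u ≟ x) cu≢x) 0<⟦⟧))
    others≡ : ∀ z → others c u z ≡ s z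
    others≡ z = +-cancelˡ-≡ ⟦ c u ≟ z ⟧ _ _ (trans (sym (size-others c u z))
      (trans (eq z) (cong (λ t → ⟦ t ≟ z ⟧ + s z) (sym at))))
    others′≡ : ∀ z → others c′ u z ≡ s z
    others′≡ z = trans (others-cong c′ c u (move-off c u y) z) (others≡ z)
    improves : utility (complete n) c u <∞ utility (complete n) c′ u
    improves = subst₂ _<∞_ (sym (utility-complete c u)) (sym (utility-complete c′ u))
      (fin<fin (ℤ.+<+ (subst₂ _<_ (sym (trans (cong (others c u) at) (others≡ x)))
        (sym (trans (cong (others c′ u) (move-at c u y)) (others′≡ y))) sx<sy)))
    sizes : ∀ z → size c′ z ≡ bump y s z
    sizes z = trans (size-others c′ u z)
      (cong₂ _+_ (cong (λ t → ⟦ t ≟ z ⟧) (move-at c u y)) (others′≡ z))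

  -- The player enters at colour `d + t` and proceeds to lower colours, whose groups are larger, so
  -- each of the `suc d` moves improves.
  walk : ∀ s x d t {ℓ} → s x < s (d + t) → (∀ i → t ≤ i → i < d + t → s (suc i) < s i) →
         Long (bump t s) ℓ → Long (bump x s) (suc d + ℓ)
  walk s x zero    t sx<st dec long = long-step s x t sx<st long
  walk s x (suc d) t sx<st dec long = long-step s x (suc d + t) sx<st
    (walk s (suc d + t) d t (dec (d + t) (m≤n+m t d) ≤-refl) (λ i t≤i i<d+t → dec i t≤i (m<n⇒m<1+n i<d+t)) long)

  -- The groups `t`, ..., `q ∸ 1` are still to grow. Each takes a singleton that walks to it from
  -- the last group, for `d + … + 1` moves in all.
  enlarge : ∀ d {q t e ℓ} → d + t ≡ q → q < e → Long (H (suc q) 0 e) ℓ → Long (H q t (d + e)) (suc d C 2 + ℓ)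
  enlarge zero    refl q<e long = long-cong (λ i → sym (H-next q<e i)) long
  enlarge (suc d) {q} {t} {e} {ℓ} refl q<e long =
    long-cong (H-supply {q} t≤ q≤)
      (subst (Long _) (trans (sym (+-assoc (suc d) _ ℓ)) (cong (_+ ℓ) (sym (C2-suc (suc d)))))
        (walk (H q t (d + e)) (d + e) d t
          (subst₂ _<_ (sym (H-empty {q} t≤ q≤)) (sym (H-group {e = d + e} (m≤n+m t d) ≤-refl)) (m<n⇒0<n∸m {d + t} ≤-refl))
          (λ i t≤i i<d+t → H-decreasing {q} {e = d + e} t≤i (s≤s i<d+t))
          (long-cong (λ i → sym (H-enlarge {e = d + e} (s≤s (m≤n+m t d)) i))
            (enlarge d {t = suc t} (+-suc d t) q<e long))))
    where
    q≤ : q ≤ d + e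
    q≤ = ≤-trans (<⇒≤ q<e) (m≤n+m e d)
    t≤ : t ≤ d + e
    t≤ = ≤-trans (m≤n+m t (suc d)) q≤

  -- Passing from the staircase of `q` to that of `suc q` uses `q` singletons and `suc q C 2` moves;
  -- Pascal's rule sums both.
  build : ∀ q {e ℓ} → q ≤ e → Long (H q 0 e) ℓ → Long (H 0 0 (q C 2 + e)) (suc q C 3 + ℓ)
  build zero    q≤e long = long
  build (suc q) {e} {ℓ} q<e long = subst₂ (λ k ℓ → Long (H 0 0 k) ℓ) colour-count length-count
    (build q (m≤m+n q e) (enlarge q (+-identityʳ q) q<e long))
    where
    colour-count : q C 2 + (q + e) ≡ suc q C 2 + e
    colour-count = trans (sym (+-assoc (q C 2) q e)) (cong (_+ e) (trans (+-comm (q C 2) q) (sym (C2-suc q))))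
    length-count : suc q C 3 + (suc q C 2 + ℓ) ≡ suc (suc q) C 3 + ℓ
    length-count = trans (sym (+-assoc (suc q C 3) _ ℓ))
      (cong (_+ ℓ) (trans (+-comm (suc q C 3) _) (sym (C3-suc (suc q)))))

  -- A player outside the heap joins it after visiting the smaller groups q, …, 1 in order of size.
  walk-to-heap : ∀ s k q x {ℓ} → s (suc x) < s q → (∀ i → i < q → s (suc i) < s i) →
                 Long (heap (suc k) s) ℓ → Long (heap k (bump (suc x) s)) (suc q + ℓ)
  walk-to-heap s k q x sx<sq dec long = long-cong (heap-bump k x s)
    (walk (heap k s) (suc x) q 0
      (subst (λ q → s (suc x) < heap k s q) (sym (+-identityʳ q)) (<-≤-trans sx<sq (heap≥ k s q)))
      (λ i _ i<q → heap-decreasing {k} {s} (dec i (subst (i <_) (+-identityʳ q) i<q)))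
      (long-cong (heap-grow k s) long))

  -- Each of the `r` leftover singletons walks through all `m` groups, ending in the heap.
  absorb-singletons : ∀ m r k {ℓ} → r ≤ m → Long (heap (r + k) (H m 0 m)) ℓ →
                      Long (heap k (H m 0 (r + m))) (r * m + ℓ)
  absorb-singletons m       zero    k _   long = long
  absorb-singletons (suc m) (suc r) k {ℓ} r<m long = long-cong (heap-cong k (H-supply {suc m} {0} z≤n (m≤n+m (suc m) r)))
    (subst (λ x → Long (heap k (bump x s)) (suc m + r * suc m + ℓ)) (sym (+-suc r m))
      (subst (Long _) (sym (+-assoc (suc m) (r * suc m) ℓ))
        (walk-to-heap s k m (r + m)
          (subst₂ _<_ (sym (trans (cong s (sym (+-suc r m))) (H-empty {suc m} {0} z≤n (m≤n+m (suc m) r))))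
            (sym (H-group {suc m} {0} {r + suc m} {m} z≤n ≤-refl)) (m<n⇒0<n∸m {m} ≤-refl))
          (λ i i<m → H-decreasing {suc m} {0} {r + suc m} z≤n (s≤s i<m))
          (absorb-singletons (suc m) r (suc k) (<⇒≤ r<m)
            (subst (λ k → Long (heap k (H (suc m) 0 (suc m))) ℓ) (sym (+-suc r k)) long)))))
    where
    s : ℕ → ℕ
    s = H (suc m) 0 (r + suc m)

  -- Groups dissolve from the smallest on, a member of group `i` making `i` moves. Apart from the
  -- `a * q` moves of group `q`, the count is the sum of `i * (m ∸ i)` over `i < q`.
  collapse : ∀ {m} q d a k → m ≡ d + q → a ≤ d →
             Long (heap k (V m q a)) (a * q + (suc q C 3 + d * (q C 2)))
  collapse zero d a k _ _ = subst (Long _) (sym (cong₂ _+_ (*-zeroʳ a) (*-zeroʳ d))) λ _ _ → done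
  -- Group `suc q` is now empty; next comes group `q`, with all its `m ∸ q = suc d` members.
  collapse {m} (suc q) d zero k m≡ _ = long-cong (heap-cong k (V-next m q)) (subst₂
    (λ a ℓ → Long (heap k (V m q a)) ℓ)
    (sym (trans (cong (_∸ q) m≡d+1+q) (m+n∸n≡m (suc d) q)))
    (trans (rearrange d q (q C 2) (suc q C 3))
      (cong₂ (λ t t′ → t + d * t′) (trans (cong (_+ suc q C 3) (sym (C2-suc q))) (sym (C3-suc (suc q)))) (sym (C2-suc q))))
    (collapse q (suc d) (suc d) k m≡d+1+q ≤-refl))
    where
    m≡d+1+q : m ≡ suc d + q
    m≡d+1+q = trans m≡ (+-suc d q)
    rearrange : ∀ d q c t → suc d * q + (t + suc d * c) ≡ (q + c + t) + d * (q + c)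
    rearrange = solve-∀
  collapse {m} (suc q) d (suc a) k m≡ a<d = long-cong (heap-cong k (V-bump m (suc q) a))
    (subst (Long _) (sym (+-assoc (suc q) (a * suc q) _))
      (walk-to-heap s k q q
        (subst₂ _<_ (sym (V-last m (suc q) a)) (sym (V-group {m} {suc q} {a} ≤-refl))
          (subst (a <_) (sym (trans (cong (_∸ q) (trans m≡ (+-suc d q))) (m+n∸n≡m (suc d) q))) (m<n⇒m<1+n a<d)))
        (λ i i<q → subst₂ _<_ (sym (V-group {m} {suc q} {a} (s≤s i<q))) (sym (V-group {m} {suc q} {a} (m<n⇒m<1+n i<q)))
          (∸-monoʳ-< (n<1+n i) (≤-trans i<q (subst (q ≤_) (sym m≡) (≤-trans (n≤1+n q) (m≤n+m (suc q) d))))))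
        (collapse (suc q) d a (suc k) m≡ (<⇒≤ a<d))))
    where
    s : ℕ → ℕ
    s = V m (suc q) a

size-singletons : ∀ {n} z → size {n} singletons z ≡ ⟦ z <? n ⟧
size-singletons {n} z with z <? n
... | yes z<n = trans
  (∑-update {f = λ _ → 0} 1 (allFin⁺ n) (∈-allFin (fromℕ< z<n))
    (λ v v≢ → ⟦⟧-false (toℕ v ≟ z) λ { refl → v≢ (sym (fromℕ<-toℕ v z<n)) })
    (⟦⟧-true (toℕ (fromℕ< z<n) ≟ z) (toℕ-fromℕ< z<n)))
  (trans (cong suc (∑-0 (allFin n))) (sym (⟦⟧-true (z <? n) z<n)))
... | no z≮n = trans
  (∑-cong (allFin n) λ v → ⟦⟧-false (toℕ v ≟ z) λ { refl → z≮n (toℕ<n v) })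
  (trans (∑-0 (allFin n)) (sym (⟦⟧-false (z <? n) z≮n)))

-- Building and collapsing the staircase take `suc m C 3` moves each, and absorbing the singletons
-- in between takes `r * m`.
complete-run : ∀ m r → r ≤ m →
               Run (complete (suc m C 2 + r)) singletons (2 * (suc m C 3) + m * r)
complete-run m r r≤m = subst (Run _ _) (rearrange m r (suc m C 3))
  (build m (m≤n+m m r)
    (long-cong (λ i → sym (heap-0 _ i))
      (absorb-singletons m r 0 r≤m
        (long-cong (heap-cong (r + 0) (V≗H m)) (collapse m 0 0 (r + 0) refl z≤n))))
    singletons sizes)
  where
  n : ℕ
  n = suc m C 2 + r
  rearrange : ∀ m r t → t + (r * m + (0 * m + (t + 0))) ≡ 2 * t + m * r
  rearrange = solve-∀
  count : n ≡ m C 2 + (r + m)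
  count = trans (cong (_+ r) (C2-suc m)) (regroup m (m C 2) r)
    where
    regroup : ∀ m c r → m + c + r ≡ c + (r + m)
    regroup = solve-∀
  sizes : ∀ z → size {n} singletons z ≡ H 0 0 (m C 2 + (r + m)) z
  sizes z = trans (size-singletons {n} z) (trans (cong (λ n → ⟦ z <? n ⟧) count)
    (sym (H-beyond {0} {0} {m C 2 + (r + m)} z≤n z≤n)))

theorem1 : ∀ (n m r : ℕ) → n ≡ (suc m C 2) + r → r ≤ m →
    (Σ ℕ λ p → Σ (Game p) λ G → p ≤ n × Uniform G × Run G singletons (2 * (suc m C 3) + m * r))
    × (∀ (p : ℕ) (G : Game p) (ℓ : ℕ) → p ≤ n → Uniform G → Run G singletons ℓ → ℓ ≤ 2 * (suc m C 3) + m * r)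
theorem1 n m r refl r≤m =
  (n , complete n , ≤-refl , (λ _ _ _ → inj₂ refl) , complete-run m r r≤m) ,
  λ p G ℓ p≤n uniform run → subst (ℓ ≤_) (cost-stair m r r≤m)
    (run≤cost G uniform (stair m r) (subst (p ≤_) (sym (sum-stair m r r≤m)) p≤n) run)
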